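{- Let $n$ be a positive integer, let $p$ be a prime and let $m$ be an integer with $1\leq m\leq p-1$. For any $(m,m)$-town$\pmod p$ family $\mathcal{F}\subseteq\mathscr{P}(n)$ we have $|\mathcal{F}|\leq 2^{\left\lfloor\frac{n+1}{2}\right\rfloor}$.
   Context: $[n]=\{1,2,\ldots,n\}$ and $\mathscr{P}(n)$ is the power set of $[n]$; a family $\mathcal{F}\subseteq\mathscr{P}(n)$ is a set of (distinct) subsets of $[n]$. For integers $k\ge 2$ and $0\le a,b\le k-1$, a family $\mathcal{F}\subseteq\mathscr{P}(n)$ is an $(a,b)$-town$\pmod k$ if for any distinct $A,B\in\mathcal{F}$ we have $|A|\equiv a\pmod k$ and $|A\cap B|\equiv b\pmod k$; that is, every set in $\mathcal{F}$ has cardinality $\equiv a\pmod k$ and every intersection of two distinct sets of $\mathcal{F}$ has cardinality $\equiv b\pmod k$. -}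

module Defs where

open import Data.Nat using (ℕ; ∣_-_∣)
open import Data.Nat.Divisibility using (_∣_)
open import Data.Fin.Subset using (Subset; _∩_; ∣_∣)
open import Data.List using (List; length)
open import Data.List.Membership.Propositional using (_∈_)
open import Data.List.Relation.Unary.Unique.Propositional using (Unique)
open import Relation.Binary.PropositionalEquality using (_≢_)

infix 4 _≡_[mod_]

_≡_[mod_] : ℕ → ℕ → ℕ → Set
a ≡ b [mod k ] = k ∣ ∣ a - b ∣

-- A set of subsets of an n-element set, enumerated without repetition, so that
-- its cardinality is the length of the enumeration.
record Family (n : ℕ) : Set where
  field
    members : List (Subset n)
    unique  : Unique members

  card : ℕ
  card = length members

-- The size condition is imposed on every member, so it is not vacuous for a
-- family with a single member.
record IsTown {n : ℕ} (a b k : ℕ) (F : Family n) : Set where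
  open Family F
  field
    size         : ∀ {A} → A ∈ members → ∣ A ∣ ≡ a [mod k ]
    intersection : ∀ {A B} → A ∈ members → B ∈ members → A ≢ B →
                   ∣ A ∩ B ∣ ≡ b [mod k ]

{-# OPTIONS --safe #-}
-- Choose a set S of coordinates minimal among those on which the members of F
-- have pairwise distinct traces.  By minimality, for each s ∈ S there are
-- members A, B agreeing on S \ {s} with s ∈ A and s ∉ B.  If two members C, D
-- agree off S, then only the coordinate s can contribute to
-- ⟨A − B, C − D⟩ = |A ∩ C| + |B ∩ D| − |A ∩ D| − |B ∩ C|, which is ≡ 0 (mod p)
-- since all four sizes are ≡ m, whereas a difference of C and D at s would make
-- it ±1.  Hence C and D also agree at s, for every
-- s ∈ S, and C = D.  So the complement of S separates F as well, and
-- |F| ≤ 2 ^ min(|S|, n − |S|).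
module Submission where

open import Data.Nat using (ℕ; _+_; _∸_; _^_; _≤_; ⌊_/2⌋)
open import Data.Nat.Primality using (Prime)
open import Defs

open import Algebra.Properties.CommutativeSemigroup using (interchange)
open import Data.Bool using (Bool; true; false; _∧_)
import Data.Bool.Properties as Bool
open import Data.Fin using (Fin; zero; suc; combine)
open import Data.Fin.Properties
  using (2↔Bool; combine-injective; injective⇒≤; suc-injective; ¬∀⟶∃¬)
  renaming (_≟_ to _≟ᶠ_; all? to allᶠ?; any? to anyᶠ?)
open import Data.Fin.Subset using (Subset; inside; outside; _∈_; _⊂_; ∁; ⊤; _∩_; ∣_∣)
  renaming (_-_ to _∖_)
open import Data.Fin.Subset.Induction using (⊂-wellFounded; Acc; acc)
open import Data.Fin.Subset.Properties
  using (_∈?_; ∈⊤; x∉p⇒x∈∁p; ∣∁p∣≡n∸∣p∣; ∣p∣≤n; x∈p∧x≢y⇒x∈p-y; x∈p⇒p-x⊂p; ∩-idem)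
open import Data.Integer using (+_; _⊖_; 1ℤ)
  renaming (∣_∣ to absℤ; _+_ to _+ℤ_; _-_ to _-ℤ_)
open import Data.Integer.Divisibility.Signed using (∣ᵤ⇒∣; ∣⇒∣ᵤ; ∣m∣n⇒∣m+n; ∣m∣n⇒∣m-n)
  renaming (_∣_ to _∣ℤ_)
open import Data.Integer.Properties using ([1+m]⊖[1+n]≡m⊖n; m-n≡m⊖n)
open import Data.Integer.Tactic.RingSolver using (solve-∀)
open import Data.List using (List)
import Data.List as List
open import Data.List.Membership.Propositional.Properties using (∈-lookup)
import Data.List.Relation.Unary.All as All
open import Data.List.Relation.Unary.AllPairs using (_∷_)
open import Data.List.Relation.Unary.Unique.Propositional using (Unique)
open import Data.Nat using (zero; suc; ∣_-_∣)
open import Data.Nat.Divisibility using (_∣_; ∣1⇒≡1)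
open import Data.Nat.Primality using (¬prime[1])
open import Data.Nat.Properties
  using (+-comm; +-suc; +-monoˡ-≤; +-monoʳ-≤; ≤-trans; ≤-total; m+[n∸m]≡n; m≤m+n; ^-monoʳ-≤;
         ⌊n/2⌋-mono; n≡⌊n+n/2⌋; +-commutativeSemigroup)
open import Data.Product using (∃; ∃₂; _×_; _,_; proj₁)
open import Data.Sum using (_⊎_; inj₁; inj₂)
open import Data.Vec using (_∷_; []; lookup; here; there)
open import Data.Vec.Properties using (tabulate∘lookup; tabulate-cong; ≡-dec)
open import Function using (_∘_)
open import Function.Bundles using (Inverse; Injection)
open import Function.Properties.Inverse using (↔⇒↣; ↔-sym)
open import Relation.Binary.PropositionalEquality
open import Relation.Nullary using (¬_; Dec; yes; no; contradiction)
open import Relation.Nullary.Decidable using (_→-dec_; _×-dec_; decidable-stable)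

private
  variable
    n L : ℕ

-- Separating sets of coordinates

Agree : Subset n → Subset n → Subset n → Set
Agree S A B = ∀ i → i ∈ S → lookup A i ≡ lookup B i

Separates : Subset n → (Fin L → Subset n) → Set
Separates S v = ∀ i j → Agree S (v i) (v j) → i ≡ j

-- Testing single deletions is enough: separation passes to supersets, so if a proper subset of `S`
-- separated, some `S ∖ s` would too.
MinimallySeparates : Subset n → (Fin L → Subset n) → Set
MinimallySeparates S v = Separates S v × (∀ s → s ∈ S → ¬ Separates (S ∖ s) v)

agree? : (S A B : Subset n) → Dec (Agree S A B)
agree? S A B = allᶠ? λ i → (i ∈? S) →-dec (lookup A i Bool.≟ lookup B i)

separates? : (S : Subset n) (v : Fin L → Subset n) → Dec (Separates S v)
separates? S v = allᶠ? λ i → allᶠ? λ j → agree? S (v i) (v j) →-dec (i ≟ᶠ j)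

lookup-extensional : (A B : Subset n) → (∀ i → lookup A i ≡ lookup B i) → A ≡ B
lookup-extensional A B eq =
  trans (sym (tabulate∘lookup A)) (trans (tabulate-cong eq) (tabulate∘lookup B))

-- Restriction to `S`, coded as a number so that injectivity turns directly into a bound on `L`.
trace : (S : Subset n) → Subset n → Fin (2 ^ ∣ S ∣)
trace []            []      = zero
trace (inside  ∷ S) (b ∷ A) = combine (Inverse.from 2↔Bool b) (trace S A)
trace (outside ∷ S) (b ∷ A) = trace S A

trace-injective : (S A B : Subset n) → trace S A ≡ trace S B → Agree S A B
trace-injective (inside ∷ S) (a ∷ A) (b ∷ B) eq =
  let a≡b , eq′ = combine-injective (Inverse.from 2↔Bool a) (trace S A) _ (trace S B) eq in λ where
    zero    here      → Injection.injective (↔⇒↣ (↔-sym 2↔Bool)) a≡b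
    (suc i) (there x) → trace-injective S A B eq′ i x
trace-injective (outside ∷ S) (a ∷ A) (b ∷ B) eq (suc i) (there x) =
  trace-injective S A B eq i x

separates⇒≤ : (S : Subset n) (v : Fin L → Subset n) → Separates S v → L ≤ 2 ^ ∣ S ∣
separates⇒≤ S v sep =
  injective⇒≤ {f = trace S ∘ v} λ {i} {j} eq → sep i j (trace-injective S (v i) (v j) eq)

-- The indices are finite and agreement is decidable, so failure of the universal statement produces
-- an explicit pair.
¬separates⇒collision : (S : Subset n) (v : Fin L → Subset n) → ¬ Separates S v →
                       ∃₂ λ i j → Agree S (v i) (v j) × i ≢ j
¬separates⇒collision S v ¬sep =
  let i , ¬i = ¬∀⟶∃¬ _ _ (λ i → allᶠ? (inner? i)) ¬sep
      j , ¬j = ¬∀⟶∃¬ _ _ (inner? i) ¬i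
  in i , j , decidable-stable (agree? S (v i) (v j)) (λ ¬agree → ¬j λ agree → contradiction agree ¬agree)
       , λ i≡j → ¬j λ _ → i≡j
  where
  inner? : ∀ i j → Dec (Agree S (v i) (v j) → i ≡ j)
  inner? i j = agree? S (v i) (v j) →-dec (i ≟ᶠ j)

-- Redundant coordinates are deleted one at a time; strict inclusion is well-founded, so this stops.
∃-minimallySeparates : (S : Subset n) (v : Fin L → Subset n) → Separates S v →
                       ∃ λ T → MinimallySeparates T v
∃-minimallySeparates S v = go S (⊂-wellFounded S)
  where
  go : ∀ S → Acc _⊂_ S → Separates S v → ∃ λ T → MinimallySeparates T v
  go S (acc rec) sep with anyᶠ? (λ s → (s ∈? S) ×-dec separates? (S ∖ s) v)
  ... | yes (s , s∈S , sep′) = go (S ∖ s) (rec (x∈p⇒p-x⊂p s∈S)) sep′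
  ... | no ∄s                = S , sep , λ s s∈S sep′ → ∄s (s , s∈S , sep′)

agree-insert : (S A B : Subset n) (s : Fin n) → Agree (S ∖ s) A B → lookup A s ≡ lookup B s →
               Agree S A B
agree-insert S A B s agree eq i i∈S with i ≟ᶠ s
... | yes refl = eq
... | no i≢s   = agree i (x∈p∧x≢y⇒x∈p-y i∈S i≢s)

-- A pair that collides once `s` is deleted must differ at `s`, since otherwise it would collide on
-- `S` itself. Swapping the pair if necessary puts `s` in the first member.
minimal⇒pivot : (S : Subset n) (v : Fin L → Subset n) → MinimallySeparates S v →
                ∀ s → s ∈ S → ∃₂ λ i j → Agree (S ∖ s) (v i) (v j) ×
                  lookup (v i) s ≡ true × lookup (v j) s ≡ false
minimal⇒pivot S v (sep , min) s s∈S
  with i , j , agree , i≢j ← ¬separates⇒collision (S ∖ s) v (min s s∈S)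
  with lookup (v i) s in eqᵢ | lookup (v j) s in eqⱼ
... | true  | false = i , j , agree , eqᵢ , eqⱼ
... | false | true  = j , i , (λ x x∈ → sym (agree x x∈)) , eqⱼ , eqᵢ
... | true  | true  =
  contradiction (sep i j (agree-insert S (v i) (v j) s agree (trans eqᵢ (sym eqⱼ)))) i≢j
... | false | false =
  contradiction (sep i j (agree-insert S (v i) (v j) s agree (trans eqᵢ (sym eqⱼ)))) i≢j

-- Exchange identities for intersection sizes

bit : Bool → ℕ
bit true  = 1
bit false = 0

∣∷∣ : (b : Bool) (S : Subset n) → ∣ b ∷ S ∣ ≡ bit b + ∣ S ∣
∣∷∣ true  S = refl
∣∷∣ false S = refl

∣∩∣+∣∩∣-∷ : (a b c d : Bool) (A B C D : Subset n) →
  ∣ (a ∷ A) ∩ (c ∷ C) ∣ + ∣ (b ∷ B) ∩ (d ∷ D) ∣ ≡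
  (bit (a ∧ c) + bit (b ∧ d)) + (∣ A ∩ C ∣ + ∣ B ∩ D ∣)
∣∩∣+∣∩∣-∷ a b c d A B C D = trans
  (cong₂ _+_ (∣∷∣ (a ∧ c) (A ∩ C)) (∣∷∣ (b ∧ d) (B ∩ D)))
  (interchange +-commutativeSemigroup (bit (a ∧ c)) (∣ A ∩ C ∣) (bit (b ∧ d)) (∣ B ∩ D ∣))

-- The condition that coordinate `i` contributes zero to ⟨A - B, C - D⟩.
AgreeAt : (A B C D : Subset n) → Fin n → Set
AgreeAt A B C D i = lookup A i ≡ lookup B i ⊎ lookup C i ≡ lookup D i

bit-exchange : (a b c d : Bool) → a ≡ b ⊎ c ≡ d →
               bit (a ∧ c) + bit (b ∧ d) ≡ bit (a ∧ d) + bit (b ∧ c)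
bit-exchange a a c d (inj₁ refl) = +-comm (bit (a ∧ c)) (bit (a ∧ d))
bit-exchange a b c c (inj₂ refl) = refl

-- The exchange lemmas evaluate ⟨A − B, C − D⟩, with both sides moved so that no
-- subtraction occurs.
agree⇒exchange : (A B C D : Subset n) → (∀ i → AgreeAt A B C D i) →
                 ∣ A ∩ C ∣ + ∣ B ∩ D ∣ ≡ ∣ A ∩ D ∣ + ∣ B ∩ C ∣
agree⇒exchange [] [] [] [] _ = refl
agree⇒exchange (a ∷ A) (b ∷ B) (c ∷ C) (d ∷ D) agree = begin
  ∣ (a ∷ A) ∩ (c ∷ C) ∣ + ∣ (b ∷ B) ∩ (d ∷ D) ∣          ≡⟨ ∣∩∣+∣∩∣-∷ a b c d A B C D ⟩
  (bit (a ∧ c) + bit (b ∧ d)) + (∣ A ∩ C ∣ + ∣ B ∩ D ∣)  ≡⟨ cong₂ _+_ (bit-exchange a b c d (agree zero))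
                                                              (agree⇒exchange A B C D (agree ∘ suc)) ⟩
  (bit (a ∧ d) + bit (b ∧ c)) + (∣ A ∩ D ∣ + ∣ B ∩ C ∣)  ≡⟨ ∣∩∣+∣∩∣-∷ a b d c A B D C ⟨
  ∣ (a ∷ A) ∩ (d ∷ D) ∣ + ∣ (b ∷ B) ∩ (c ∷ C) ∣          ∎
  where open ≡-Reasoning

pivot⇒exchange : (A B C D : Subset n) (s : Fin n) →
                 lookup A s ≡ true → lookup B s ≡ false → lookup C s ≡ true → lookup D s ≡ false →
                 (∀ i → i ≢ s → AgreeAt A B C D i) →
                 ∣ A ∩ C ∣ + ∣ B ∩ D ∣ ≡ suc (∣ A ∩ D ∣ + ∣ B ∩ C ∣)
-- The pivot adds one to `∣ A ∩ C ∣` and nothing to the other three sizes.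
pivot⇒exchange (true ∷ A) (false ∷ B) (true ∷ C) (false ∷ D) zero refl refl refl refl agree =
  cong suc (agree⇒exchange A B C D λ i → agree (suc i) λ ())
pivot⇒exchange (a ∷ A) (b ∷ B) (c ∷ C) (d ∷ D) (suc s) As Bs Cs Ds agree = begin
  ∣ (a ∷ A) ∩ (c ∷ C) ∣ + ∣ (b ∷ B) ∩ (d ∷ D) ∣             ≡⟨ ∣∩∣+∣∩∣-∷ a b c d A B C D ⟩
  (bit (a ∧ c) + bit (b ∧ d)) + (∣ A ∩ C ∣ + ∣ B ∩ D ∣)     ≡⟨ cong₂ _+_ (bit-exchange a b c d (agree zero λ ()))
                                                                 (pivot⇒exchange A B C D s As Bs Cs Ds
                                                                   λ i i≢s → agree (suc i) (i≢s ∘ suc-injective)) ⟩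
  (bit (a ∧ d) + bit (b ∧ c)) + suc (∣ A ∩ D ∣ + ∣ B ∩ C ∣) ≡⟨ +-suc _ _ ⟩
  suc ((bit (a ∧ d) + bit (b ∧ c)) + (∣ A ∩ D ∣ + ∣ B ∩ C ∣)) ≡⟨ cong suc (∣∩∣+∣∩∣-∷ a b d c A B D C) ⟨
  suc (∣ (a ∷ A) ∩ (d ∷ D) ∣ + ∣ (b ∷ B) ∩ (c ∷ C) ∣)       ∎
  where open ≡-Reasoning

-- Congruences as signed divisibility

∣⊖∣≡∣-∣ : ∀ x y → absℤ (x ⊖ y) ≡ ∣ x - y ∣
∣⊖∣≡∣-∣ zero    zero    = refl
∣⊖∣≡∣-∣ zero    (suc y) = refl
∣⊖∣≡∣-∣ (suc x) zero    = refl
∣⊖∣≡∣-∣ (suc x) (suc y) = trans (cong absℤ ([1+m]⊖[1+n]≡m⊖n x y)) (∣⊖∣≡∣-∣ x y)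

mod⇒∣ : ∀ {k} x y → x ≡ y [mod k ] → + k ∣ℤ + x -ℤ + y
mod⇒∣ {k} x y k∣ =
  ∣ᵤ⇒∣ (subst (k ∣_) (sym (trans (cong absℤ (m-n≡m⊖n x y)) (∣⊖∣≡∣-∣ x y))) k∣)

-- In (w - m) + (x - m) - (y - m) - (z - m) the four copies of `m` cancel, leaving 1, while `k`
-- divides each bracket.
offByOne⇒∣1 : ∀ {k m} w x y z → w ≡ m [mod k ] → x ≡ m [mod k ] → y ≡ m [mod k ] → z ≡ m [mod k ] →
              w + x ≡ suc (y + z) → k ∣ 1
offByOne⇒∣1 {k} {m} w x y z w≡m x≡m y≡m z≡m eq = ∣⇒∣ᵤ (subst (+ k ∣ℤ_) difference
  (∣m∣n⇒∣m-n (∣m∣n⇒∣m+n (mod⇒∣ w m w≡m) (mod⇒∣ x m x≡m))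
             (∣m∣n⇒∣m+n (mod⇒∣ y m y≡m) (mod⇒∣ z m z≡m))))
  where
  open ≡-Reasoning
  regroup : ∀ w x y z m → ((w -ℤ m) +ℤ (x -ℤ m)) -ℤ ((y -ℤ m) +ℤ (z -ℤ m)) ≡ (w +ℤ x) -ℤ (y +ℤ z)
  regroup = solve-∀
  cancel : ∀ t → (1ℤ +ℤ t) -ℤ t ≡ 1ℤ
  cancel = solve-∀
  difference : ((+ w -ℤ + m) +ℤ (+ x -ℤ + m)) -ℤ ((+ y -ℤ + m) +ℤ (+ z -ℤ + m)) ≡ 1ℤ
  difference = begin
    _                               ≡⟨ regroup (+ w) (+ x) (+ y) (+ z) (+ m) ⟩
    + (w + x) -ℤ + (y + z)          ≡⟨ cong (λ t → + t -ℤ + (y + z)) eq ⟩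
    (1ℤ +ℤ + (y + z)) -ℤ + (y + z)  ≡⟨ cancel (+ (y + z)) ⟩
    1ℤ                              ∎

-- The complement separates, and the bound

minimal⇒∁-separates : ∀ {k m} → k ≢ 1 → (v : Fin L → Subset n) → (∀ i j → ∣ v i ∩ v j ∣ ≡ m [mod k ]) →
                      (S : Subset n) → MinimallySeparates S v → Separates (∁ S) v
minimal⇒∁-separates {L} {n} {k} {m} k≢1 v v∩v≡m S minS@(sep , _) i j agree-∁S =
  sep i j λ s s∈S → agreeAt s s∈S
  where
  clash : ∀ i j s → s ∈ S → Agree (∁ S) (v i) (v j) → lookup (v i) s ≡ true → ¬ lookup (v j) s ≡ false
  clash i j s s∈S agree-∁S vi∋s vj∌s
    with a , b , agree , va∋s , vb∌s ← minimal⇒pivot S v minS s s∈S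
    = k≢1 (∣1⇒≡1 (offByOne⇒∣1 {m = m}
        (∣ v a ∩ v i ∣) (∣ v b ∩ v j ∣) (∣ v a ∩ v j ∣) (∣ v b ∩ v i ∣)
        (v∩v≡m a i) (v∩v≡m b j) (v∩v≡m a j) (v∩v≡m b i)
        (pivot⇒exchange (v a) (v b) (v i) (v j) s va∋s vb∌s vi∋s vj∌s elsewhere)))
    where
    -- Away from `s`, the pivot pair agrees inside `S` and the pair `i`, `j` agrees outside it, so
    -- every other term vanishes.
    elsewhere : ∀ x → x ≢ s → AgreeAt (v a) (v b) (v i) (v j) x
    elsewhere x x≢s with x ∈? S
    ... | yes x∈S = inj₁ (agree x (x∈p∧x≢y⇒x∈p-y x∈S x≢s))
    ... | no  x∉S = inj₂ (agree-∁S x (x∉p⇒x∈∁p x∉S))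

  agreeAt : ∀ s → s ∈ S → lookup (v i) s ≡ lookup (v j) s
  agreeAt s s∈S with lookup (v i) s in eqᵢ | lookup (v j) s in eqⱼ
  ... | true  | true  = refl
  ... | false | false = refl
  ... | true  | false = contradiction eqⱼ (clash i j s s∈S agree-∁S eqᵢ)
  ... | false | true  = contradiction eqᵢ (clash j i s s∈S (λ x x∈ → sym (agree-∁S x x∈)) eqⱼ)

m+m≤n⇒m≤⌊n/2⌋ : ∀ {m n} → m + m ≤ n → m ≤ ⌊ n /2⌋
m+m≤n⇒m≤⌊n/2⌋ {m} {n} m+m≤n = subst (_≤ ⌊ n /2⌋) (sym (n≡⌊n+n/2⌋ m)) (⌊n/2⌋-mono m+m≤n)

m+n≡o⇒m≤⌊o/2⌋⊎n≤⌊o/2⌋ : ∀ m n {o} → m + n ≡ o → m ≤ ⌊ o /2⌋ ⊎ n ≤ ⌊ o /2⌋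
m+n≡o⇒m≤⌊o/2⌋⊎n≤⌊o/2⌋ m n refl with ≤-total m n
... | inj₁ m≤n = inj₁ (m+m≤n⇒m≤⌊n/2⌋ (+-monoʳ-≤ m m≤n))
... | inj₂ n≤m = inj₂ (m+m≤n⇒m≤⌊n/2⌋ (+-monoˡ-≤ n n≤m))

-- Both `S` and `∁ S` separate, and their sizes add up to `n`, so the smaller one gives the bound.
-- The case `i ≡ j` of the congruence hypothesis is the size condition.
injective-≤2^⌊n/2⌋ : ∀ {k m} → k ≢ 1 → (v : Fin L → Subset n) → (∀ i j → v i ≡ v j → i ≡ j) →
                     (∀ i j → ∣ v i ∩ v j ∣ ≡ m [mod k ]) → L ≤ 2 ^ ⌊ n /2⌋
injective-≤2^⌊n/2⌋ {L} {n} {m = m} k≢1 v v-inj v∩v≡m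
  with S , minS ← ∃-minimallySeparates ⊤ v
         (λ i j agree → v-inj i j (lookup-extensional (v i) (v j) λ x → agree x ∈⊤))
  with m+n≡o⇒m≤⌊o/2⌋⊎n≤⌊o/2⌋ (∣ S ∣) (∣ ∁ S ∣)
         (trans (cong (λ c → ∣ S ∣ + c) (∣∁p∣≡n∸∣p∣ S)) (m+[n∸m]≡n (∣p∣≤n S)))
... | inj₁ ∣S∣≤  = ≤-trans (separates⇒≤ S v (proj₁ minS)) (^-monoʳ-≤ 2 ∣S∣≤)
... | inj₂ ∣∁S∣≤ = ≤-trans (separates⇒≤ (∁ S) v (minimal⇒∁-separates {m = m} k≢1 v v∩v≡m S minS))
                           (^-monoʳ-≤ 2 ∣∁S∣≤)

lookup-injective : ∀ {a} {X : Set a} {xs : List X} → Unique xs →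
                   ∀ i j → List.lookup xs i ≡ List.lookup xs j → i ≡ j
lookup-injective (x∉ ∷ u) zero    zero    eq = refl
lookup-injective (x∉ ∷ u) zero    (suc j) eq = contradiction eq (All.lookup x∉ (∈-lookup j))
lookup-injective (x∉ ∷ u) (suc i) zero    eq = contradiction (sym eq) (All.lookup x∉ (∈-lookup i))
lookup-injective (x∉ ∷ u) (suc i) (suc j) eq = cong suc (lookup-injective u i j eq)

proposition1p4 : ∀ (n p m : ℕ) → 1 ≤ n → Prime p → 1 ≤ m → m ≤ p ∸ 1 →
    (F : Family n) → IsTown m m p F →
    Family.card F ≤ 2 ^ ⌊ n + 1 /2⌋
proposition1p4 n p m _ p-prime _ _ F town = ≤-trans
    (injective-≤2^⌊n/2⌋ {m = m} (λ { refl → ¬prime[1] p-prime }) v (lookup-injective unique) v∩v≡m)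
    -- The bound obtained has exponent `⌊ n /2⌋`, which is at most `⌊ n + 1 /2⌋`.
    (^-monoʳ-≤ 2 (⌊n/2⌋-mono (m≤m+n n 1)))
  where
  open Family F
  open IsTown town
  v : Fin card → Subset n
  v = List.lookup members
  v∩v≡m : ∀ i j → ∣ v i ∩ v j ∣ ≡ m [mod p ]
  v∩v≡m i j with ≡-dec Bool._≟_ (v i) (v j)
  ... | no  vi≢vj = intersection (∈-lookup i) (∈-lookup j) vi≢vj
  -- Equal members meet in the member itself, so the size condition supplies the congruence.
  ... | yes vi≡vj = subst (λ A → ∣ A ∣ ≡ m [mod p ])
          (trans (sym (∩-idem (v i))) (cong (v i ∩_) vi≡vj)) (size (∈-lookup i))
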